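{- If $k\ge 3$ and $n\ge 3$ is odd then there exists a maximal $\mathcal{NAS}_k(n)$.
   Context: For a sequence $S=(s_i)_{i\ge0}$ with entries in $\mathbb{Z}_k$ write $\mathbf{s}_n(i)=(s_i,\dots,s_{i+n-1})$; an $n$-tuple occurs in $S$ if it equals $\mathbf{s}_n(i)$ for some $i$. A $k$-ary $n$-window sequence is a periodic sequence over $\mathbb{Z}_k$, of period $m$ say, such that $\mathbf{s}_n(i)=\mathbf{s}_n(j)$ implies $i\equiv j\pmod m$. For $k\ge3$, $n\ge2$, an $\mathcal{NAS}_k(n)$ ($k$-ary Negative Avoiding Sequence of span $n$) is a $k$-ary $n$-window sequence $S$ such that whenever an $n$-tuple $\mathbf{a}=(a_0,\dots,a_{n-1})$ occurs in $S$, its negative $-\mathbf{a}=(-a_0,\dots,-a_{n-1})$ does not occur in $S$. An $\mathcal{NAS}_k(n)$ is maximal if its period equals $\frac{k^n-1}{2}$ when $k$ is odd, or $\frac{k^n-2^n}{2}$ when $k$ is even. -}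

module Defs where

open import Data.Fin.Base using (Fin; toℕ)
open import Data.Nat.Base using (ℕ; suc; _+_; _∸_; _^_; _<_; ∣_-_∣)
open import Data.Nat.DivMod using (_/_; _mod_)
open import Data.Nat.Divisibility using (_∣_; _∤_)
open import Data.Product.Base using (_×_; ∃-syntax)
open import Data.Vec.Base using (Vec; tabulate; map)
open import Relation.Binary.PropositionalEquality.Core using (_≡_)
open import Relation.Nullary.Negation.Core using (¬_)

-- ℤₖ is represented by its standard residues, the elements of Fin k.
neg : ∀ {k} → Fin k → Fin k
neg {k = k@(suc _)} a = (k ∸ toℕ a) mod k

Sequence : ℕ → Set
Sequence k = ℕ → Fin k

window : ∀ {k} (n : ℕ) → Sequence k → ℕ → Vec (Fin k) n
window n s i = tabulate (λ j → s (i + toℕ j))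

Occurs : ∀ {k n} → Vec (Fin k) n → Sequence k → Set
Occurs {n = n} a s = ∃[ i ] a ≡ window n s i

HasPeriod : ∀ {k} → Sequence k → ℕ → Set
HasPeriod s m = 0 < m × (∀ i → s (i + m) ≡ s i)

-- The congruence i ≡ j (mod m) is stated as m ∣ ∣ i - j ∣.  For n-window
-- sequences the last condition forces m to be the least period.
IsWindowSequence : ∀ {k} → ℕ → Sequence k → ℕ → Set
IsWindowSequence n s m =
  HasPeriod s m × (∀ i j → window n s i ≡ window n s j → m ∣ ∣ i - j ∣)

record NAS (k n : ℕ) : Set where
  field
    seq      : Sequence k
    period   : ℕ
    isWindow : IsWindowSequence n seq period
    avoids   : ∀ (a : Vec (Fin k) n) → Occurs a seq → ¬ Occurs (map neg a) seq

-- In each case the subtraction is not truncated (for k ≥ 2) and the halving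
-- is exact.
IsMaximal : ∀ {k n} → NAS k n → Set
IsMaximal {k} {n} S =
  (2 ∤ k → NAS.period S ≡ (k ^ n ∸ 1) / 2) ×
  (2 ∣ k → NAS.period S ≡ (k ^ n ∸ 2 ^ n) / 2)

{-# OPTIONS --safe #-}

-- Rotation of n-tuples is a permutation, and for odd n a tuple a ≠ -a is not a
-- rotation of -a: if ρ a = -a for a power ρ of the rotation, then
-- a = ρⁿ a = (-1)ⁿ a = -a.  One class can therefore be chosen from each pair of
-- opposite rotation classes.  We take the one with more entries 1 than entries
-- -1, and use an arbitrary total order of the classes to break ties.
--
-- On the chosen tuples the rotation is a permutation sending each tuple to one
-- that overlaps it in n - 1 entries.  This overlap survives composition with the
-- transposition of two tuples that share their last n - 1 entries, and such a
-- composition merges the cycles of the two tuples if they are different.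
-- Replacing an entry by 1 leads from a chosen tuple to a chosen tuple, so every
-- chosen tuple is linked to (1, …, 1) and the merging ends in a single cycle
-- through all chosen tuples, which spells the required sequence.
module Submission where

open import Defs
open import Data.Bool.Base using (true; false)
open import Data.Fin.Base using (Fin; zero; suc; toℕ; inject₁; fromℕ<)
open import Data.Fin.Properties
  using (pigeonhole; toℕ-injective; toℕ-fromℕ<; toℕ<n; toℕ-inject₁) renaming (_≟_ to _≟F_)
open import Data.List.Base as List
  using (List; []; _∷_; length; applyUpTo; filter; cartesianProduct; cartesianProductWith)
open import Data.List.Extrema.Nat using (argmax; argmax-all; f[xs]≤f[argmax])
open import Data.List.Membership.Propositional using (_∈_)
open import Data.List.Membership.Propositional.Properties
  using (∈-applyUpTo⁺; ∈-applyUpTo⁻; ∈-filter⁺; ∈-cartesianProduct⁺; ∈-cartesianProductWith⁺;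
         ∈-cartesianProductWith⁻; ∈-++⁺ˡ; ∈-++⁺ʳ; ∈-++⁻; ∈-map⁺; ∈-map⁻; ∈-allFin)
open import Data.List.Membership.Propositional.Properties.WithK using (unique∧set⇒bag)
open import Data.List.Membership.Setoid.Properties using (index-injective)
import Data.List.Properties as List
open import Data.List.Relation.Binary.BagAndSetEquality using (∼bag⇒↭)
open import Data.List.Relation.Binary.Permutation.Propositional.Properties using (↭-length)
open import Data.List.Relation.Unary.All as All using (All; []; _∷_)
open import Data.List.Relation.Unary.All.Properties using (all-filter)
open import Data.List.Relation.Unary.AllPairs using ([]; _∷_)
open import Data.List.Relation.Unary.Any using (here; there; index)
open import Data.List.Relation.Unary.Unique.Propositional using (Unique)
import Data.List.Relation.Unary.Unique.Propositional.Properties as Unique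
open import Data.Nat.Base
open import Data.Nat.DivMod using (_%_; m≡m%n+[m/n]*n; m%n<n; n%n≡0; m<n⇒m%n≡m; m*n/n≡m)
open import Data.Nat.Divisibility using (_∣_; _∤_; divides; _∣?_; ∣⇒≤; m%n≡0⇒n∣m)
open import Data.Nat.GeneralisedArithmetic using (fold; fold-+)
open import Data.Nat.Induction using (<-rec)
open import Data.Nat.Properties renaming (_≟_ to _≟ℕ_)
open import Data.Product.Base using (Σ-syntax; ∃-syntax; _×_; _,_; proj₁; proj₂)
open import Data.Product.Relation.Binary.Lex.Strict using (×-Lex; ×-asymmetric; ×-decidable)
open import Data.Sum.Base using (_⊎_; inj₁; inj₂)
open import Data.Vec.Base
  using (Vec; []; _∷_; _∷ʳ_; map; toList; replicate; count; tail; init; head; lookup)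
open import Data.Vec.Properties
  using (∷-injective; ∷-injectiveˡ; ∷-injectiveʳ; ∷ʳ-injective; init-∷ʳ; toList-∷ʳ; toList-injective;
         toList-replicate; length-toList; cast-is-id; ≡-dec; map-∘; map-cong; map-id; map-∷ʳ;
         tabulate-cong; tabulate∘lookup)
open import Function.Base using (_∘_; id)
open import Function.Bundles using (mk⇔)
open import Function.Definitions using (Injective)
open import Level using (0ℓ)
open import Relation.Binary.Core using (Rel)
open import Relation.Binary.Definitions
  using (Decidable; DecidableEquality; Symmetric; tri<; tri≈; tri>)
open import Relation.Binary.PropositionalEquality
open import Relation.Nullary.Decidable
  using (Dec; yes; no; does; map′; _×-dec_; dec-true; dec-false)
open import Relation.Nullary.Negation using (¬_; contradiction)
open import Relation.Unary using (Pred) renaming (Decidable to Decidable₁)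

-- Iterates of a function and reachability

least : {P : Pred ℕ 0ℓ} → Decidable₁ P → ∀ n → P n → ∃[ m ] P m × (∀ {j} → j < m → ¬ P j)
least {P} P? = <-rec _ search
  where
  search : ∀ n → (∀ {j} → j < n → P j → ∃[ m ] P m × (∀ {i} → i < m → ¬ P i)) →
           P n → ∃[ m ] P m × (∀ {i} → i < m → ¬ P i)
  search n rec Pn with anyUpTo? P? n
  ... | yes (j , j<n , Pj) = rec j<n Pj
  ... | no ¬below          = n , Pn , λ i<n Pi → ¬below (_ , i<n , Pi)

fold-comm : {X : Set} {f g : X → X} → (∀ x → g (f x) ≡ f (g x)) →
            ∀ i x → g (fold x f i) ≡ fold (g x) f i
fold-comm         comm zero    x = refl
fold-comm {f = f} comm (suc i) x = trans (comm _) (cong f (fold-comm comm i x))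

fold-shift : {X : Set} (f : X → X) → ∀ i x → fold (f x) f i ≡ f (fold x f i)
fold-shift f i x = sym (fold-comm {f = f} {g = f} (λ _ → refl) i x)

fold-fixed : {X : Set} (f : X → X) → ∀ {p x} → fold x f p ≡ x → ∀ q → fold x f (q * p) ≡ x
fold-fixed f         fixed zero    = refl
fold-fixed f {p} {x} fixed (suc q) = begin
  fold x f (p + q * p)       ≡⟨ fold-+ x f p ⟩
  fold (fold x f (q * p)) f p ≡⟨ cong (λ y → fold y f p) (fold-fixed f fixed q) ⟩
  fold x f p                 ≡⟨ fixed ⟩
  x                          ∎
  where open ≡-Reasoning

fold-injective : {X : Set} {f : X → X} → Injective _≡_ _≡_ f →
                 ∀ i {x y} → fold x f i ≡ fold y f i → x ≡ y
fold-injective inj zero    eq = eq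
fold-injective inj (suc i) eq = fold-injective inj i (inj eq)

fold-cancel : {X : Set} {f : X → X} → Injective _≡_ _≡_ f →
              ∀ {x i j} → i ≤ j → fold x f i ≡ fold x f j → fold x f (j ∸ i) ≡ x
fold-cancel {f = f} inj {x} {i} {j} i≤j eq = sym (fold-injective inj i (begin
  fold x f i                  ≡⟨ eq ⟩
  fold x f j                  ≡⟨ cong (fold x f) (m+[n∸m]≡n i≤j) ⟨
  fold x f (i + (j ∸ i))      ≡⟨ fold-+ x f i ⟩
  fold (fold x f (j ∸ i)) f i ∎))
  where open ≡-Reasoning

Reaches : {X : Set} → (X → X) → Rel X 0ℓ
Reaches f x y = ∃[ i ] fold x f i ≡ y

module _ {X : Set} {f : X → X} where

  reaches-step : ∀ x → Reaches f x (f x)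
  reaches-step x = 1 , refl

  reaches-trans : ∀ {x y z} → Reaches f x y → Reaches f y z → Reaches f x z
  reaches-trans {x} (i , refl) (j , refl) = j + i , fold-+ x f j

  -- Each step of `f` is replaced by a run of steps of `g`. This carries reachability over to a
  -- permutation with merged cycles.
  reaches-extend : ∀ {g : X → X} → (∀ x → Reaches g x (f x)) → ∀ {x y} → Reaches f x y → Reaches g x y
  reaches-extend step (zero , refl)  = 0 , refl
  reaches-extend {g} step {x} (suc i , refl) with reaches-extend {g} step {x} (i , refl)
  ... | j , eq with step (fold x f i)
  ... | l , eq′ = l + j , trans (fold-+ x g l) (trans (cong (λ y → fold y g l) eq) eq′)

  reaches-preserves : ∀ {P : Pred X 0ℓ} → (∀ {x} → P x → P (f x)) → ∀ {x y} → Reaches f x y → P x → P y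
  reaches-preserves step (zero , refl)  Px = Px
  reaches-preserves {P} step {x} (suc i , refl) Px = step (reaches-preserves {P} step {x} (i , refl) Px)

-- Cycles of a permutation of a finite set

module Finite {X : Set} (_≟X_ : DecidableEquality X)
              (elements : List X) (complete : ∀ x → x ∈ elements) where

  -- An injective numbering: equal positions hold equal elements, even if the list has repetitions.
  code : X → ℕ
  code x = toℕ (index (complete x))

  module Permutation {f : X → X} (f-injective : Injective _≡_ _≡_ f) where

    abstract
      -- Among one more iterate than there are list positions, two must coincide, and injectivity
      -- cancels their common initial steps.
      returns : ∀ x → ∃[ p ] fold x f (suc p) ≡ x
      returns x with pigeonhole ≤-refl (λ i → index (complete (fold x f (toℕ {suc (length elements)} i))))
      ... | i , j , i<j , eq with m≤n⇒∃[o]m+o≡n i<j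
      ... | d , i+d≡j = d , trans (cong (fold x f) j∸i) back
        where
        back : fold x f (toℕ j ∸ toℕ i) ≡ x
        back = fold-cancel f-injective (<⇒≤ i<j) (index-injective (setoid X) (complete _) (complete _) eq)
        j∸i : suc d ≡ toℕ j ∸ toℕ i
        j∸i = begin
          suc d                     ≡⟨ m+n∸m≡n (toℕ i) (suc d) ⟨
          toℕ i + suc d ∸ toℕ i     ≡⟨ cong (_∸ toℕ i) (+-suc (toℕ i) d) ⟩
          suc (toℕ i + d) ∸ toℕ i   ≡⟨ cong (_∸ toℕ i) i+d≡j ⟩
          toℕ j ∸ toℕ i             ∎
          where open ≡-Reasoning

    reaches-sym : Symmetric (Reaches f)
    reaches-sym {x} (i , refl) with returns x
    -- The `i` steps already made and `i * p` further ones are `i` full rounds of length `suc p`.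
    ... | p , back = i * p , (begin
      fold (fold x f i) f (i * p) ≡⟨ fold-+ x f (i * p) ⟨
      fold x f (i * p + i)        ≡⟨ cong (fold x f) (+-comm (i * p) i) ⟩
      fold x f (i + i * p)        ≡⟨ cong (fold x f) (*-suc i p) ⟨
      fold x f (i * suc p)        ≡⟨ fold-fixed f back i ⟩
      x                           ∎)
      where open ≡-Reasoning

    fold-% : ∀ {p x} → fold x f (suc p) ≡ x → ∀ i → fold x f (i % suc p) ≡ fold x f i
    fold-% {p} {x} back i = begin
      fold x f (i % suc p)                                ≡⟨ cong (λ y → fold y f (i % suc p))
                                                                  (fold-fixed f back (i / suc p)) ⟨
      fold (fold x f (i / suc p * suc p)) f (i % suc p)   ≡⟨ fold-+ x f (i % suc p) ⟨
      fold x f (i % suc p + i / suc p * suc p)            ≡⟨ cong (fold x f) (m≡m%n+[m/n]*n i (suc p)) ⟨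
      fold x f i                                          ∎
      where open ≡-Reasoning

    abstract
      reaches? : Decidable (Reaches f)
      reaches? x y with returns x
      ... | p , back = map′ (λ (i , _ , eq) → i , eq)
                            (λ (i , eq) → i % suc p , m%n<n i (suc p) , trans (fold-% back i) eq)
                            (anyUpTo? (λ i → fold x f i ≟X y) (suc p))

      -- The orbit element of largest code, the same for all points of a cycle. The default `x` of
      -- `argmax` lies in the orbit as well.
      representative : X → X
      representative x = argmax code x (filter (reaches? x) elements)

      reaches-representative : ∀ x → Reaches f x (representative x)
      reaches-representative x = argmax-all code (0 , refl) (all-filter (reaches? x) elements)

      -- The representative of `y` is itself in the orbit of `x`, so it competes in the maximum for
      -- `x`.
      code-representative : ∀ {x y} → Reaches f x y → code (representative y) ≤ code (representative x)
      code-representative {x} {y} x⟶y =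
        All.lookup (f[xs]≤f[argmax] {f = code} x _)
          (∈-filter⁺ (reaches? x) (complete _) (reaches-trans x⟶y (reaches-representative y)))

      representative-cong : ∀ {x y} → Reaches f x y → code (representative x) ≡ code (representative y)
      representative-cong x⟶y = ≤-antisym (code-representative (reaches-sym x⟶y)) (code-representative x⟶y)

      representative-reflects : ∀ {x y} → code (representative x) ≡ code (representative y) → Reaches f x y
      representative-reflects {x} {y} eq =
        reaches-trans (reaches-representative x)
          (subst (λ z → Reaches f z y) (sym same) (reaches-sym (reaches-representative y)))
        where
        same : representative x ≡ representative y
        same = index-injective (setoid X) (complete _) (complete _) (toℕ-injective eq)

    -- `distinct` makes `size` the exact length of the cycle; it becomes the window property of the
    -- sequence.
    record Cycle (x : X) : Set where
      field
        size     : ℕ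
        size>0   : 0 < size
        closed   : fold x f size ≡ x
        distinct : ∀ {i j} → i ≤ j → fold x f i ≡ fold x f j → size ∣ j ∸ i

      orbit : List X
      orbit = applyUpTo (fold x f) size

      orbit-unique : Unique orbit
      orbit-unique = Unique.applyUpTo⁺₁ (fold x f) size (λ {i} {j} i<j j<L eq →
        -- A positive difference below `size` cannot be a multiple of `size`.
        <⇒≱ (≤-<-trans (m∸n≤m j i) j<L) (∣⇒≤ {{>-nonZero (m<n⇒0<n∸m i<j)}} (distinct {i} {j} (<⇒≤ i<j) eq)))

      ∈-orbit⁺ : ∀ {y} → Reaches f x y → y ∈ orbit
      ∈-orbit⁺ (i , refl) with size | closed | size>0
      ... | suc p | back | _ = subst (_∈ applyUpTo (fold x f) (suc p)) (fold-% back i)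
                                 (∈-applyUpTo⁺ (fold x f) (m%n<n i (suc p)))

      ∈-orbit⁻ : ∀ {y} → y ∈ orbit → Reaches f x y
      ∈-orbit⁻ y∈ with ∈-applyUpTo⁻ (fold x f) y∈
      ... | i , _ , refl = i , refl

    abstract
      cycle : ∀ x → Cycle x
      -- Searching over `suc p` excludes the trivial return after 0 steps.
      cycle x with least (λ p → fold x f (suc p) ≟X x) (proj₁ (returns x)) (proj₂ (returns x))
      ... | p , back , minimal = record
        { size     = suc p
        ; size>0   = z<s
        ; closed   = back
        ; distinct = λ {i} {j} i≤j eq → m%n≡0⇒n∣m (j ∸ i) (suc p)
                       (vanishes _ (m%n<n (j ∸ i) (suc p))
                         (trans (fold-% back (j ∸ i)) (fold-cancel f-injective i≤j eq)))
        }
        where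
        vanishes : ∀ r → r < suc p → fold x f r ≡ x → r ≡ 0
        vanishes zero    _     _  = refl
        vanishes (suc r) r<p eq = contradiction eq (minimal (s<s⁻¹ r<p))

  open Permutation

  -- Merging cycles by transpositions

  transpose : X → X → X → X
  transpose a b x with x ≟X a
  ... | yes _ = b
  ... | no  _ with x ≟X b
  ...   | yes _ = a
  ...   | no  _ = x

  -- The graph of the transposition; matching on it yields the case and the value together.
  data Transposed (a b x : X) : X → Set where
    first  : x ≡ a → Transposed a b x b
    second : x ≡ b → Transposed a b x a
    other  : x ≢ a → x ≢ b → Transposed a b x x

  transposed : ∀ a b x → Transposed a b x (transpose a b x)
  transposed a b x with x ≟X a
  ... | yes x≡a = first x≡a
  ... | no  x≢a with x ≟X b
  ...   | yes x≡b = second x≡b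
  ...   | no  x≢b = other x≢a x≢b

  transpose-injective : ∀ a b → Injective _≡_ _≡_ (transpose a b)
  transpose-injective a b {x} {y} eq
    with transpose a b x | transpose a b y | transposed a b x | transposed a b y
  transpose-injective a b refl | _ | _ | first refl  | first refl  = refl
  transpose-injective a b refl | _ | _ | first refl  | second refl = refl
  transpose-injective a b refl | _ | _ | first refl  | other _ y≢b = contradiction refl y≢b
  transpose-injective a b refl | _ | _ | second refl | first refl  = refl
  transpose-injective a b refl | _ | _ | second refl | second refl = refl
  transpose-injective a b refl | _ | _ | second refl | other y≢a _ = contradiction refl y≢a
  transpose-injective a b refl | _ | _ | other _ x≢b | first refl  = contradiction refl x≢b
  transpose-injective a b refl | _ | _ | other x≢a _ | second refl = contradiction refl x≢a
  transpose-injective a b refl | _ | _ | other _ _   | other _ _   = refl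

  transpose-first : ∀ a b → transpose a b a ≡ b
  transpose-first a b with transpose a b a | transposed a b a
  ... | _ | first _     = refl
  ... | _ | second refl = refl
  ... | _ | other a≢a _ = contradiction refl a≢a

  transpose-second : ∀ a b → transpose a b b ≡ a
  transpose-second a b with transpose a b b | transposed a b b
  ... | _ | first refl  = refl
  ... | _ | second _    = refl
  ... | _ | other _ b≢b = contradiction refl b≢b

  transpose-other : ∀ a b {x} → x ≢ a → x ≢ b → transpose a b x ≡ x
  transpose-other a b {x} x≢a x≢b with transpose a b x | transposed a b x
  ... | _ | first x≡a  = contradiction x≡a x≢a
  ... | _ | second x≡b = contradiction x≡b x≢b
  ... | _ | other _ _  = refl

  module Merge {f : X → X} (f-injective : Injective _≡_ _≡_ f)
               {a b : X} (apart : ¬ Reaches f a b) where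

    -- The points `a` and `b` exchange their successors, which splices their two cycles into one.
    merged : X → X
    merged = f ∘ transpose a b

    merged-injective : Injective _≡_ _≡_ merged
    merged-injective = transpose-injective a b ∘ f-injective

    private
      -- The cycle of b avoids a, so merged follows f along it until it returns to b.
      along-cycle-of-b : ∀ i → Reaches merged a (fold b f (suc i))
      along-cycle-of-b zero = 1 , cong f (transpose-first a b)
      along-cycle-of-b (suc i) with fold b f (suc i) ≟X b
      -- The round is complete, so the next element is `f b` again, one step from `a`.
      ... | yes eq = 1 , trans (cong f (transpose-first a b)) (cong f (sym eq))
      ... | no ≢b  = reaches-trans (along-cycle-of-b i) (1 , cong f (transpose-other a b ≢a ≢b))
        where
        ≢a : fold b f (suc i) ≢ a
        ≢a eq = apart (reaches-sym f-injective (suc i , eq))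

    joins : Reaches merged a b
    joins with returns f-injective b
    ... | p , back = subst (Reaches merged a) back (along-cycle-of-b p)

    -- Merging loses no connection: `a` and `b` now share a cycle, so each reaches its old successor
    -- by way of the other.
    merged-step : ∀ x → Reaches merged x (f x)
    merged-step x with x ≟X a
    ... | yes refl = reaches-trans joins (1 , cong f (transpose-second a b))
    ... | no x≢a with x ≟X b
    ...   | yes refl = reaches-trans (reaches-sym merged-injective joins) (1 , cong f (transpose-first a b))
    ...   | no x≢b   = 1 , cong f (transpose-other a b x≢a x≢b)

  module _ {Step R : Rel X 0ℓ} (R? : Decidable R) (R-sym : Symmetric R)
           (Step-resp : ∀ {x y z} → R x y → Step x z → Step y z) where

    private
      Joined : (X → X) → List (X × X) → (X → X) → Set
      Joined f₀ pairs f =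
        Injective _≡_ _≡_ f × (∀ x → Step x (f x)) × (∀ x → Reaches f x (f₀ x)) ×
        All (λ (x , y) → R x y → Reaches f x y) pairs

      -- Induction on the list of pairs: related points on different cycles are merged, and later
      -- merges never separate what is already joined.
      joinAll : ∀ {f₀} → Injective _≡_ _≡_ f₀ → (∀ x → Step x (f₀ x)) →
                ∀ pairs → Σ[ f ∈ (X → X) ] Joined f₀ pairs f
      joinAll {f₀} inj step [] = f₀ , inj , step , (λ _ → 1 , refl) , []
      joinAll inj step ((a , b) ∷ pairs) with joinAll inj step pairs
      ... | f , inj′ , step′ , extends , joined with R? a b | reaches? inj′ a b
      ...   | no ¬r | _       = f , inj′ , step′ , extends , (λ r → contradiction r ¬r) ∷ joined
      ...   | yes _ | yes a⟶b = f , inj′ , step′ , extends , (λ _ → a⟶b) ∷ joined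
      ...   | yes r | no apart =
        merged , merged-injective , merged-steps ,
        (λ x → reaches-extend merged-step (extends x)) ,
        (λ _ → joins) ∷ All.map (reaches-extend merged-step ∘_) joined
        where
        open Merge inj′ apart
        merged-steps : ∀ x → Step x (merged x)
        -- Only `a` and `b` get new successors, each that of the other; as they are related,
        -- `Step-resp` permits the exchange.
        merged-steps x with transpose a b x | transposed a b x
        ... | _ | first refl  = Step-resp (R-sym r) (step′ b)
        ... | _ | second refl = Step-resp r (step′ a)
        ... | _ | other _ _   = step′ x

    joinCycles : ∀ {f₀} → Injective _≡_ _≡_ f₀ → (∀ x → Step x (f₀ x)) →
                 Σ[ f ∈ (X → X) ] Injective _≡_ _≡_ f × (∀ x → Step x (f x)) ×
                   (∀ x → Reaches f x (f₀ x)) × (∀ {x y} → R x y → Reaches f x y)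
    joinCycles inj step with joinAll inj step (cartesianProduct elements elements)
    ... | f , inj′ , step′ , extends , joined =
      f , inj′ , step′ , extends ,
      λ {x} {y} → All.lookup joined (∈-cartesianProduct⁺ (complete x) (complete y))

-- Counting the tuples over a list of letters

length-cartesianProductWith : {A B C : Set} (f : A → B → C) (xs : List A) (ys : List B) →
                              length (cartesianProductWith f xs ys) ≡ length xs * length ys
length-cartesianProductWith f []       ys = refl
length-cartesianProductWith f (x ∷ xs) ys = begin
  length (List.map (f x) ys List.++ rest)    ≡⟨ List.length-++ (List.map (f x) ys) ⟩
  length (List.map (f x) ys) + length rest   ≡⟨ cong (_+ length rest) (List.length-map (f x) ys) ⟩
  length ys + length rest                    ≡⟨ cong (length ys +_) (length-cartesianProductWith f xs ys) ⟩
  length ys + length xs * length ys          ∎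
  where
  open ≡-Reasoning
  rest = cartesianProductWith f xs ys

words : {A : Set} → List A → ∀ n → List (Vec A n)
words xs zero    = [] ∷ []
words xs (suc n) = cartesianProductWith _∷_ xs (words xs n)

module _ {A : Set} {xs : List A} where

  length-words : ∀ n → length (words xs n) ≡ length xs ^ n
  length-words zero    = refl
  length-words (suc n) =
    trans (length-cartesianProductWith _∷_ xs (words xs n)) (cong (length xs *_) (length-words n))

  words-unique : Unique xs → ∀ n → Unique (words xs n)
  words-unique xs! zero    = [] ∷ []
  words-unique xs! (suc n) = Unique.cartesianProductWith⁺ _∷_ ∷-injective xs! (words-unique xs! n)

  words-complete : (∀ x → x ∈ xs) → ∀ {n} (v : Vec A n) → v ∈ words xs n
  words-complete all []      = here refl
  words-complete all (x ∷ v) = ∈-cartesianProductWith⁺ _∷_ (all x) (words-complete all v)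

  module _ {ν : A → A} where

    -- A map applied entrywise fixes a tuple exactly when it fixes every entry. With the converse
    -- below, this counts the tuples equal to their negatives.
    ∈-words-fixed⁺ : (∀ {x} → ν x ≡ x → x ∈ xs) → ∀ {n} (v : Vec A n) → map ν v ≡ v → v ∈ words xs n
    ∈-words-fixed⁺ fixed []      _  = here refl
    ∈-words-fixed⁺ fixed (x ∷ v) eq =
      ∈-cartesianProductWith⁺ _∷_ (fixed (∷-injectiveˡ eq)) (∈-words-fixed⁺ fixed v (∷-injectiveʳ eq))

    ∈-words-fixed⁻ : (∀ {x} → x ∈ xs → ν x ≡ x) → ∀ {n} {v : Vec A n} → v ∈ words xs n → map ν v ≡ v
    ∈-words-fixed⁻ fixed {zero}  {[]} _ = refl
    ∈-words-fixed⁻ fixed {suc n} v∈ with ∈-cartesianProductWith⁻ _∷_ xs (words xs n) v∈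
    ... | _ , _ , x∈ , w∈ , refl = cong₂ _∷_ (fixed x∈) (∈-words-fixed⁻ fixed w∈)

sameElements⇒sameLength : {A : Set} {xs ys : List A} → Unique xs → Unique ys →
  (∀ {x} → x ∈ xs → x ∈ ys) → (∀ {x} → x ∈ ys → x ∈ xs) → length xs ≡ length ys
sameElements⇒sameLength xs! ys! ⊆ ⊇ = ↭-length (∼bag⇒↭ (unique∧set⇒bag xs! ys! (mk⇔ ⊆ ⊇)))

toList-cancel : {A : Set} → ∀ {n} {v w : Vec A n} → toList v ≡ toList w → v ≡ w
toList-cancel {v = v} {w} eq = trans (sym (cast-is-id refl v)) (toList-injective refl v w eq)

-- Rotating tuples and overwriting their entries

module Rotation {A : Set} {m : ℕ} where

  rotate : Vec A (suc m) → Vec A (suc m)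
  rotate (x ∷ v) = v ∷ʳ x

  -- The rotation of the tuple whose first entry has been replaced by `t`.
  push : A → Vec A (suc m) → Vec A (suc m)
  push t (_ ∷ v) = v ∷ʳ t

  rotate-injective : Injective _≡_ _≡_ rotate
  rotate-injective {x ∷ v} {y ∷ w} eq with ∷ʳ-injective v w eq
  ... | refl , refl = refl

  tail≡init-rotate : ∀ x → tail x ≡ init (rotate x)
  tail≡init-rotate (x ∷ v) = sym (init-∷ʳ x v)

  -- The split into `xs` and `ys` carries the induction: each rotation moves the head of `xs` to the
  -- end of `ys`. Lists avoid casts between vector lengths.
  toList-rotations : ∀ (xs ys : List A) x → toList x ≡ xs List.++ ys →
                     toList (fold x rotate (length xs)) ≡ ys List.++ xs
  toList-rotations []       ys v       eq = trans eq (sym (List.++-identityʳ ys))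
  toList-rotations (z ∷ zs) ys (x ∷ v) eq = begin
    toList (rotate (fold (x ∷ v) rotate l))   ≡⟨ cong toList (fold-shift rotate l (x ∷ v)) ⟨
    toList (fold (v ∷ʳ x) rotate l)           ≡⟨ toList-rotations zs (ys List.∷ʳ z) (v ∷ʳ x) start ⟩
    (ys List.∷ʳ z) List.++ zs                 ≡⟨ List.++-assoc ys (z ∷ []) zs ⟩
    ys List.++ (z ∷ zs)                       ∎
    where
    open ≡-Reasoning
    l = length zs
    start : toList (v ∷ʳ x) ≡ zs List.++ (ys List.∷ʳ z)
    start = begin
      toList (v ∷ʳ x)                  ≡⟨ toList-∷ʳ x v ⟩
      toList v List.∷ʳ x               ≡⟨ cong₂ List._∷ʳ_ (List.∷-injectiveʳ eq) (List.∷-injectiveˡ eq) ⟩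
      (zs List.++ ys) List.∷ʳ z        ≡⟨ List.++-assoc zs ys (z ∷ []) ⟩
      zs List.++ (ys List.∷ʳ z)        ∎

  toList-pushes : ∀ t (xs ys : List A) x → toList x ≡ xs List.++ ys →
                  toList (fold x (push t) (length xs)) ≡ ys List.++ List.replicate (length xs) t
  toList-pushes t []       ys v       eq = trans eq (sym (List.++-identityʳ ys))
  toList-pushes t (z ∷ zs) ys (x ∷ v) eq = begin
    toList (push t (fold (x ∷ v) (push t) l))         ≡⟨ cong toList (fold-shift (push t) l (x ∷ v)) ⟨
    toList (fold (v ∷ʳ t) (push t) l)                 ≡⟨ toList-pushes t zs (ys List.∷ʳ t) (v ∷ʳ t) start ⟩
    (ys List.∷ʳ t) List.++ List.replicate l t         ≡⟨ List.++-assoc ys (t ∷ []) _ ⟩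
    ys List.++ List.replicate (suc l) t               ∎
    where
    open ≡-Reasoning
    l = length zs
    start : toList (v ∷ʳ t) ≡ zs List.++ (ys List.∷ʳ t)
    start = begin
      toList (v ∷ʳ t)                  ≡⟨ toList-∷ʳ t v ⟩
      toList v List.∷ʳ t               ≡⟨ cong (List._∷ʳ t) (List.∷-injectiveʳ eq) ⟩
      (zs List.++ ys) List.∷ʳ t        ≡⟨ List.++-assoc zs ys (t ∷ []) ⟩
      zs List.++ (ys List.∷ʳ t)        ∎

  rotate-full : ∀ x → fold x rotate (suc m) ≡ x
  rotate-full x = begin
    fold x rotate (suc m)              ≡⟨ cong (fold x rotate) (length-toList x) ⟨
    fold x rotate (length (toList x))  ≡⟨ toList-cancel (toList-rotations (toList x) [] x start) ⟩
    x                                  ∎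
    where
    open ≡-Reasoning
    start : toList x ≡ toList x List.++ []
    start = sym (List.++-identityʳ (toList x))

  push-full : ∀ t x → fold x (push t) (suc m) ≡ replicate (suc m) t
  push-full t x = toList-cancel (begin
    toList (fold x (push t) (suc m))              ≡⟨ cong (toList ∘ fold x (push t)) (length-toList x) ⟨
    toList (fold x (push t) (length (toList x)))  ≡⟨ toList-pushes t (toList x) [] x (sym (List.++-identityʳ _)) ⟩
    List.replicate (length (toList x)) t          ≡⟨ cong (λ l → List.replicate l t) (length-toList x) ⟩
    List.replicate (suc m) t                      ≡⟨ toList-replicate (suc m) t ⟨
    toList (replicate (suc m) t)                  ∎)
    where open ≡-Reasoning

-- Negation and rotation of tuples of odd length

-- The letters, ν and t stand for ℤₖ, negation and 1.
module Construction
  {A : Set} (_≟_ : DecidableEquality A)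
  {letters : List A} (letters-unique : Unique letters) (letters-complete : ∀ x → x ∈ letters)
  {ν : A → A} (ν-involutive : ∀ x → ν (ν x) ≡ x)
  {fixed : List A} (fixed-unique : Unique fixed)
  (fixed⁺ : ∀ {x} → ν x ≡ x → x ∈ fixed) (fixed⁻ : ∀ {x} → x ∈ fixed → ν x ≡ x)
  {t : A} (νt≢t : ν t ≢ t) (h : ℕ)
  where

  m n : ℕ
  m = h * 2
  n = suc m

  Tuple : Set
  Tuple = Vec A n

  tuples : List Tuple
  tuples = words letters n

  _≟T_ : DecidableEquality Tuple
  _≟T_ = ≡-dec _≟_

  open Rotation {A} {m}
  open Finite _≟T_ tuples (words-complete letters-complete)
  open Permutation using (reaches-sym; representative; representative-cong;
                           representative-reflects; module Cycle; cycle)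

  negate : ∀ {l} → Vec A l → Vec A l
  negate = map ν

  negate-involutive : ∀ {l} (v : Vec A l) → negate (negate v) ≡ v
  negate-involutive v = trans (sym (map-∘ ν ν v)) (trans (map-cong ν-involutive v) (map-id v))

  negate-rotate : ∀ x → negate (rotate x) ≡ rotate (negate x)
  negate-rotate (x ∷ v) = map-∷ʳ ν x v

  negate-rotations : ∀ i x → negate (fold x rotate i) ≡ fold (negate x) rotate i
  negate-rotations = fold-comm negate-rotate

  rotation-of-negative : ∀ {x} → Reaches rotate x (negate x) → negate x ≡ x
  rotation-of-negative {x} (i , eq) = begin
    negate x               ≡⟨ eq ⟨
    -- The square of `ρ` fixes `x` and `n` is `suc (h * 2)`, so `ρ` may be replaced by its `n`th
    -- power, which is a power of the full rotation.
    ρ x                    ≡⟨ cong ρ (even h) ⟨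
    fold x ρ n             ≡⟨ powers n ⟩
    fold x rotate (n * i)  ≡⟨ cong (fold x rotate) (*-comm n i) ⟩
    fold x rotate (i * n)  ≡⟨ fold-fixed rotate (rotate-full x) i ⟩
    x                      ∎
    where
    open ≡-Reasoning
    ρ : Tuple → Tuple
    ρ y = fold y rotate i
    powers : ∀ l → fold x ρ l ≡ fold x rotate (l * i)
    powers zero    = refl
    powers (suc l) = trans (cong ρ (powers l)) (sym (fold-+ x rotate i))
    twice : ρ (ρ x) ≡ x
    twice = begin
      ρ (ρ x)         ≡⟨ cong ρ eq ⟩
      ρ (negate x)    ≡⟨ negate-rotations i x ⟨
      negate (ρ x)    ≡⟨ cong negate eq ⟩
      negate (negate x) ≡⟨ negate-involutive x ⟩
      x               ∎
    even : ∀ l → fold x ρ (l * 2) ≡ x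
    even zero    = refl
    even (suc l) = trans (cong (ρ ∘ ρ) (even l)) twice

  -- Choosing between opposite tuples

  -- Since `ν` is an involution, `tally (negate x)` is the number of entries `ν t` of `x`.
  tally : ∀ {l} → Vec A l → ℕ
  tally = count (_≟ t)

  tally-t : ∀ {l} (v : Vec A l) → tally (t ∷ v) ≡ suc (tally v)
  tally-t v rewrite dec-true (t ≟ t) refl = refl

  tally-other : ∀ {l x} (v : Vec A l) → x ≢ t → tally (x ∷ v) ≡ tally v
  tally-other {x = x} v x≢t rewrite dec-false (x ≟ t) x≢t = refl

  tally-≤-∷ : ∀ {l} x (v : Vec A l) → tally v ≤ tally (x ∷ v)
  tally-≤-∷ x v with does (x ≟ t)
  ... | true  = n≤1+n _
  ... | false = ≤-refl

  tally-∷ʳ : ∀ {l} (v : Vec A l) x → tally (v ∷ʳ x) ≡ tally (x ∷ v)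
  tally-∷ʳ []      x = refl
  tally-∷ʳ (y ∷ v) x with does (y ≟ t) | does (x ≟ t) | tally-∷ʳ v x
  ... | true  | true  | eq = cong suc eq
  ... | true  | false | eq = cong suc eq
  ... | false | true  | eq = eq
  ... | false | false | eq = eq

  abstract
    class : Tuple → ℕ
    class x = code (representative rotate-injective x)

    class-rotate : ∀ x → class (rotate x) ≡ class x
    class-rotate x = sym (representative-cong rotate-injective {x} {rotate x} (reaches-step x))

    class-reflects : ∀ {x y} → class x ≡ class y → Reaches rotate x y
    class-reflects = representative-reflects rotate-injective

  -- The count comes first: replacing an entry by `t` has no controlled effect on the class, but it
  -- moves the counts in favour of the tuple.
  weight : Tuple → ℕ × ℕ
  weight x = tally x , class x

  weight-rotate : ∀ x → weight (rotate x) ≡ weight x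
  weight-rotate x@(y ∷ v) =
    cong₂ _,_ (tally-∷ʳ v y) (class-rotate x)

  infix 4 _≺_ _≺?_
  _≺_ : ℕ × ℕ → ℕ × ℕ → Set
  _≺_ = ×-Lex _≡_ _<_ _<_

  _≺?_ : Decidable _≺_
  _≺?_ = ×-decidable _≟ℕ_ _<?_ _<?_

  Positive : Tuple → Set
  Positive x = weight (negate x) ≺ weight x

  positive? : Decidable₁ Positive
  positive? x = weight (negate x) ≺? weight x

  positive-asym : ∀ {x} → Positive x → ¬ Positive (negate x)
  positive-asym {x} pos neg =
    ×-asymmetric {_<₁_ = _<_} {_<₂_ = _<_} sym (resp₂ _<_) <-asym <-asym
      {weight (negate x)} {weight x} pos
      (subst (λ y → weight y ≺ weight (negate x)) (negate-involutive x) neg)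

  negate-positive : ∀ {x} → weight x ≺ weight (negate x) → Positive (negate x)
  negate-positive {x} = subst (λ y → weight y ≺ weight (negate x)) (sym (negate-involutive x))

  positive-trichotomy : ∀ x → Positive x ⊎ Positive (negate x) ⊎ negate x ≡ x
  positive-trichotomy x with <-cmp (tally (negate x)) (tally x)
  ... | tri< lt _ _ = inj₁ (inj₁ lt)
  ... | tri> _ _ gt = inj₂ (inj₁ (negate-positive (inj₁ gt)))
  ... | tri≈ _ eq _ with <-cmp (proj₂ (weight (negate x))) (proj₂ (weight x))
  ...   | tri< lt _ _ = inj₁ (inj₂ (eq , lt))
  ...   | tri> _ _ gt = inj₂ (inj₁ (negate-positive (inj₂ (sym eq , gt))))
  -- A tie in both components puts `x` and its negative in one rotation class, and odd length makes
  -- them equal.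
  ...   | tri≈ _ eq′ _ = inj₂ (inj₂ (rotation-of-negative (class-reflects (sym eq′))))

  positive-rotate : ∀ {x} → Positive x → Positive (rotate x)
  positive-rotate {x} = subst₂ _≺_
    (sym (trans (cong weight (negate-rotate x)) (weight-rotate (negate x))))
    (sym (weight-rotate x))

  tally-negate : ∀ {x} → Positive x → tally (negate x) ≤ tally x
  tally-negate (inj₁ lt)       = <⇒≤ lt
  tally-negate (inj₂ (eq , _)) = ≤-reflexive eq

  -- A new `t` raises the count of `t` by one and, as `t` differs from `ν t`, adds no `ν t`. The
  -- comparison of counts becomes strict even if only the tie-break made the old tuple positive.
  positive-raise : ∀ x (v : Vec A m) → Positive (x ∷ v) → Positive (t ∷ v)
  positive-raise x v pos = raise (x ≟ t)
    where
    open ≤-Reasoning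
    raise : Dec (x ≡ t) → Positive (t ∷ v)
    raise (yes x≡t) = subst (λ y → Positive (y ∷ v)) x≡t pos
    raise (no x≢t)  = inj₁ (begin-strict
      tally (negate (t ∷ v)) ≡⟨ tally-other (negate v) νt≢t ⟩
      tally (negate v)       ≤⟨ tally-≤-∷ (ν x) (negate v) ⟩
      tally (negate (x ∷ v)) ≤⟨ tally-negate pos ⟩
      tally (x ∷ v)          ≡⟨ tally-other v x≢t ⟩
      tally v                <⟨ n<1+n _ ⟩
      suc (tally v)          ≡⟨ tally-t v ⟨
      tally (t ∷ v)          ∎)

  -- One cycle through all positive tuples

  top : Tuple
  top = replicate n t

  positive-top : Positive top
  positive-top = inj₁ (begin-strict
    tally (negate top)             ≡⟨ none n ⟩
    0                              <⟨ z<s ⟩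
    suc (tally (replicate m t))    ≡⟨ tally-t (replicate m t) ⟨
    tally top                      ∎)
    where
    open ≤-Reasoning
    none : ∀ l → tally (negate (replicate l t)) ≡ 0
    none zero    = refl
    none (suc l) = trans (tally-other (negate (replicate l t)) νt≢t) (none l)

  -- The permutation lives on all tuples, so `Step` also demands that it preserve positivity, and
  -- `R` restricts merging to positive tuples with a common tail.
  Step R : Tuple → Tuple → Set
  Step x y = tail x ≡ init y × (Positive x → Positive y)
  R x y = tail x ≡ tail y × Positive x × Positive y

  abstract
    joined : Σ[ f ∈ (Tuple → Tuple) ] Injective _≡_ _≡_ f × (∀ x → Step x (f x)) ×
             (∀ x → Reaches f x (rotate x)) × (∀ {x y} → R x y → Reaches f x y)
    joined = joinCycles {Step} {R}
      (λ x y → ≡-dec _≟_ (tail x) (tail y) ×-dec positive? x ×-dec positive? y)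
      (λ (eq , p , q) → sym eq , q , p)
      -- The relation `R` provides positivity of `x`, and hence of its successor.
      (λ (eq , p , q) (eq′ , p⇒) → trans (sym eq) eq′ , λ _ → p⇒ p)
      rotate-injective
      (λ x → tail≡init-rotate x , positive-rotate)

  next : Tuple → Tuple
  next = proj₁ joined

  next-injective : Injective _≡_ _≡_ next
  next-injective = proj₁ (proj₂ joined)

  tail≡init-next : ∀ x → tail x ≡ init (next x)
  tail≡init-next x = proj₁ (proj₁ (proj₂ (proj₂ joined)) x)

  positive-next : ∀ {x} → Positive x → Positive (next x)
  positive-next {x} = proj₂ (proj₁ (proj₂ (proj₂ joined)) x)

  -- The tuples `x ∷ v` and `t ∷ v` are linked by their common tail, and the rotation of `t ∷ v` is
  -- still reachable after all merges.
  push-reached : ∀ {x} → Positive x → Reaches next x (push t x) × Positive (push t x)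
  push-reached {x ∷ v} pos with joined | positive-raise x v pos
  ... | f , _ , _ , extends , linked | pos′ =
    reaches-trans (linked (refl , pos , pos′)) (extends (t ∷ v)) , positive-rotate pos′

  -- After `n` pushes every entry has been overwritten by `t`.
  top-reached : ∀ {x} → Positive x → Reaches next x top
  top-reached {x} pos = subst (Reaches next x) (push-full t x) (proj₁ (pushes n))
    where
    pushes : ∀ i → Reaches next x (fold x (push t) i) × Positive (fold x (push t) i)
    pushes zero    = (0 , refl) , pos
    pushes (suc i) with pushes i
    ... | reached , pos′ with push-reached pos′
    ...   | reached′ , pos″ = reaches-trans reached reached′ , pos″

  open Cycle (cycle next-injective top) public

  orbit-positive : ∀ {x} → Reaches next top x → Positive x
  orbit-positive r = reaches-preserves {P = Positive} positive-next r positive-top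

  -- Counting the positive tuples

  private
    negatives : List Tuple
    negatives = List.map negate orbit

    negatives-unique : Unique negatives
    negatives-unique = Unique.map⁺ (λ {x} {y} eq →
      trans (sym (negate-involutive x)) (trans (cong negate eq) (negate-involutive y))) orbit-unique

    negative : ∀ {x} → x ∈ negatives → Positive (negate x)
    negative x∈ with ∈-map⁻ negate x∈
    ... | y , y∈ , refl = subst Positive (sym (negate-involutive y)) (orbit-positive (∈-orbit⁻ y∈))

    positive : ∀ {x} → Positive x → x ∈ orbit
    positive pos = ∈-orbit⁺ (reaches-sym next-injective (top-reached pos))

    -- The positive tuples, their negatives and the tuples equal to their negatives partition all
    -- tuples; comparing lengths determines `size`.
    everything : List Tuple
    everything = orbit List.++ negatives List.++ words fixed n

    everything-unique : Unique everything
    everything-unique =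
      Unique.++⁺ orbit-unique (Unique.++⁺ negatives-unique (words-unique fixed-unique n)
        (λ (neg , fix) → apart′ (negative neg) fix))
        (λ (pos , rest) → apart (orbit-positive (∈-orbit⁻ pos)) (∈-++⁻ negatives rest))
      where
      irrefl : ∀ {x} → Positive x → negate x ≢ x
      irrefl pos eq = positive-asym pos (subst Positive (sym eq) pos)
      apart′ : ∀ {x} → Positive (negate x) → ¬ x ∈ words fixed n
      apart′ pos fix = irrefl pos (cong negate (∈-words-fixed⁻ fixed⁻ fix))
      apart : ∀ {x} → Positive x → ¬ (x ∈ negatives ⊎ x ∈ words fixed n)
      apart pos (inj₁ neg) = positive-asym pos (negative neg)
      apart pos (inj₂ fix) = irrefl pos (∈-words-fixed⁻ fixed⁻ fix)

    everything-complete : ∀ x → x ∈ everything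
    everything-complete x with positive-trichotomy x
    ... | inj₁ pos        = ∈-++⁺ˡ (positive pos)
    ... | inj₂ (inj₁ neg) = ∈-++⁺ʳ orbit (∈-++⁺ˡ
      (subst (_∈ negatives) (negate-involutive x) (∈-map⁺ negate (positive neg))))
    ... | inj₂ (inj₂ eq)  = ∈-++⁺ʳ orbit (∈-++⁺ʳ negatives (∈-words-fixed⁺ fixed⁺ x eq))

  count-tuples : size + (size + length fixed ^ n) ≡ length letters ^ n
  count-tuples = begin
    size + (size + F)
      ≡⟨ cong₂ (λ a b → a + (b + F)) length-orbit (trans (List.length-map negate orbit) length-orbit) ⟨
    length orbit + (length negatives + F)
      ≡⟨ cong (λ l → length orbit + (length negatives + l)) (length-words {xs = fixed} n) ⟨
    length orbit + (length negatives + length (words fixed n))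
      ≡⟨ cong (length orbit +_) (List.length-++ negatives) ⟨
    length orbit + length (negatives List.++ words fixed n)
      ≡⟨ List.length-++ orbit ⟨
    length everything
      ≡⟨ sameElements⇒sameLength everything-unique (words-unique letters-unique n)
           (λ _ → words-complete letters-complete _) (λ _ → everything-complete _) ⟩
    length tuples
      ≡⟨ length-words {xs = letters} n ⟩
    length letters ^ n
      ∎
    where
    open ≡-Reasoning
    F : ℕ
    F = length fixed ^ n
    length-orbit : length orbit ≡ size
    length-orbit = List.length-applyUpTo (fold top next) size

-- Negation of residues

module _ {k : ℕ} where

  private
    K : ℕ
    K = suc k

  toℕ-neg : ∀ (x : Fin K) → toℕ (neg x) ≡ (K ∸ toℕ x) % K
  toℕ-neg x = toℕ-fromℕ< (m%n<n (K ∸ toℕ x) K)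

  neg-zero : neg {K} zero ≡ zero
  neg-zero = toℕ-injective (trans (toℕ-neg zero) (n%n≡0 K))

  -- For a nonzero residue the difference is already below the modulus. The additive form keeps
  -- truncated subtraction out of later arguments.
  neg-suc : ∀ (x : Fin k) → toℕ (neg {K} (suc x)) + toℕ (suc x) ≡ K
  neg-suc x = begin
    toℕ (neg {K} (suc x)) + suc (toℕ x)      ≡⟨ cong (_+ suc (toℕ x)) (toℕ-neg (suc x)) ⟩
    (K ∸ suc (toℕ x)) % K + suc (toℕ x)      ≡⟨ cong (_+ suc (toℕ x)) (m<n⇒m%n≡m (s≤s (m∸n≤m k (toℕ x)))) ⟩
    K ∸ suc (toℕ x) + suc (toℕ x)            ≡⟨ m∸n+n≡m (<⇒≤ (toℕ<n (suc x))) ⟩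
    K                                        ∎
    where open ≡-Reasoning

  neg-involutive : ∀ (x : Fin K) → neg (neg x) ≡ x
  neg-involutive zero    = trans (cong neg neg-zero) neg-zero
  neg-involutive (suc x) with neg {K} (suc x) | neg-suc x
  -- A nonzero residue with negative 0 would have to equal the modulus.
  ... | zero  | eq = contradiction eq (<⇒≢ (toℕ<n (suc x)))
  ... | suc y | eq = toℕ-injective (+-cancelʳ-≡ (toℕ (suc y)) _ _
                       (trans (neg-suc y) (trans (sym eq) (+-comm (toℕ (suc y)) (toℕ (suc x))))))

  neg-fixed⁺ : ∀ {x : Fin K} → neg x ≡ x → x ≡ zero ⊎ toℕ x * 2 ≡ K
  neg-fixed⁺ {zero}  _  = inj₁ refl
  neg-fixed⁺ {suc x} eq = inj₂ (begin
    toℕ (suc x) * 2                        ≡⟨ *-comm (toℕ (suc x)) 2 ⟩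
    toℕ (suc x) + (toℕ (suc x) + 0)        ≡⟨ cong (toℕ (suc x) +_) (+-identityʳ _) ⟩
    toℕ (suc x) + toℕ (suc x)              ≡⟨ cong (λ y → toℕ y + toℕ (suc x)) eq ⟨
    toℕ (neg {K} (suc x)) + toℕ (suc x)    ≡⟨ neg-suc x ⟩
    K                                      ∎)
    where open ≡-Reasoning

  neg-fixed⁻ : ∀ {x : Fin K} → toℕ x * 2 ≡ K → neg x ≡ x
  neg-fixed⁻ {suc x} eq = toℕ-injective (+-cancelʳ-≡ (toℕ (suc x)) _ _ (begin
    toℕ (neg {K} (suc x)) + toℕ (suc x)    ≡⟨ neg-suc x ⟩
    K                                      ≡⟨ eq ⟨
    toℕ (suc x) * 2                        ≡⟨ *-comm (toℕ (suc x)) 2 ⟩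
    toℕ (suc x) + (toℕ (suc x) + 0)        ≡⟨ cong (toℕ (suc x) +_) (+-identityʳ _) ⟩
    toℕ (suc x) + toℕ (suc x)              ∎))
    where open ≡-Reasoning

-- The sequence spelled by overlapping tuples

lookup-init : {A : Set} → ∀ {n} (x : Vec A (suc n)) i → lookup (init x) i ≡ lookup x (inject₁ i)
lookup-init (x ∷ y ∷ v) zero    = refl
lookup-init (x ∷ y ∷ v) (suc i) = lookup-init (y ∷ v) i

module _ {A : Set} {n : ℕ} {f : Vec A (suc n) → Vec A (suc n)}
         (shifted : ∀ x → tail x ≡ init (f x)) where

  -- Each step moves the entries one place forward, so entry `d` is the head after `d` steps. The
  -- recursion is on `d` because `inject₁ j` is not a subterm of `suc j`.
  lookup-iterate : ∀ d x (j : Fin (suc n)) → toℕ j ≡ d → lookup x j ≡ head (fold x f d)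
  lookup-iterate zero    (a ∷ v)   zero    refl = refl
  lookup-iterate (suc d) x@(a ∷ v) (suc j) eq   = begin
    lookup v j                ≡⟨ cong (λ w → lookup w j) (shifted x) ⟩
    lookup (init (f x)) j     ≡⟨ lookup-init (f x) j ⟩
    lookup (f x) (inject₁ j)  ≡⟨ lookup-iterate d (f x) (inject₁ j) (trans (toℕ-inject₁ j) (suc-injective eq)) ⟩
    head (fold (f x) f d)     ≡⟨ cong head (fold-shift f d x) ⟩
    head (f (fold x f d))     ∎
    where open ≡-Reasoning

-- The windows of the sequence of heads are the iterates themselves, so window properties can be
-- read off the orbit.
window-iterate : ∀ {k n} {f : Vec (Fin k) (suc n) → Vec (Fin k) (suc n)} → (∀ x → tail x ≡ init (f x)) →
                 ∀ x i → window (suc n) (λ l → head (fold x f l)) i ≡ fold x f i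
window-iterate {f = f} shifted x i = trans (tabulate-cong entry) (tabulate∘lookup (fold x f i))
  where
  open ≡-Reasoning
  entry : ∀ j → head (fold x f (i + toℕ j)) ≡ lookup (fold x f i) j
  entry j = begin
    head (fold x f (i + toℕ j))           ≡⟨ cong (head ∘ fold x f) (+-comm i (toℕ j)) ⟩
    head (fold x f (toℕ j + i))           ≡⟨ cong head (fold-+ x f (toℕ j)) ⟩
    head (fold (fold x f i) f (toℕ j))    ≡⟨ lookup-iterate shifted (toℕ j) (fold x f i) j refl ⟨
    lookup (fold x f i) j                 ∎

-- Negative avoiding sequences and their periods

-- The residues equal to their negatives are a parameter, so that one construction serves both
-- parities of `k`.
negativeAvoiding : ∀ {k} → 3 ≤ k → ∀ h {fixed : List (Fin k)} → Unique fixed →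
  (∀ {x} → neg x ≡ x → x ∈ fixed) → (∀ {x} → x ∈ fixed → neg x ≡ x) →
  Σ[ S ∈ NAS k (suc (h * 2)) ] NAS.period S + (NAS.period S + length fixed ^ suc (h * 2)) ≡ k ^ suc (h * 2)
negativeAvoiding {k@(suc (suc (suc k′)))} (s≤s (s≤s (s≤s _))) h {fixed} fixed! fixed⁺ fixed⁻ =
  record
    { seq      = seq
    ; period   = size
    ; isWindow = (size>0 , periodic) , windows
    ; avoids   = avoids
    } ,
  subst (λ l → size + (size + length fixed ^ n) ≡ l ^ n) (List.length-tabulate {n = k} id) count-tuples
  where
  -- Here `3 ≤ k` enters: 1 is neither 0 nor half of `k`.
  neg1≢1 : neg {k} (suc zero) ≢ suc zero
  neg1≢1 eq with neg-fixed⁺ eq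
  ... | inj₂ ()

  open Construction _≟F_ (Unique.allFin⁺ k) ∈-allFin neg-involutive fixed! fixed⁺ fixed⁻ neg1≢1 h

  seq : Sequence k
  seq i = head (fold top next i)

  window-seq : ∀ i → window n seq i ≡ fold top next i
  window-seq = window-iterate tail≡init-next top

  periodic : ∀ i → seq (i + size) ≡ seq i
  periodic i = cong head (trans (fold-+ top next i) (cong (λ x → fold x next i) closed))

  windows : ∀ i j → window n seq i ≡ window n seq j → size ∣ ∣ i - j ∣
  windows i j eq with ≤-total i j | trans (sym (window-seq i)) (trans eq (window-seq j))
  ... | inj₁ i≤j | eq′ = subst (size ∣_) (sym (m≤n⇒∣m-n∣≡n∸m i≤j)) (distinct i≤j eq′)
  ... | inj₂ j≤i | eq′ = subst (size ∣_) (sym (m≤n⇒∣n-m∣≡n∸m j≤i)) (distinct j≤i (sym eq′))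

  occurs⇒positive : ∀ {a} → Occurs a seq → Positive a
  occurs⇒positive (i , eq) = orbit-positive (i , sym (trans eq (window-seq i)))

  avoids : ∀ a → Occurs a seq → ¬ Occurs (map neg a) seq
  avoids a pos neg = positive-asym (occurs⇒positive pos) (occurs⇒positive neg)

halve : ∀ {s c a} → s + (s + c) ≡ a → s ≡ (a ∸ c) / 2
halve {s} {c} refl = sym (begin
  (s + (s + c) ∸ c) / 2  ≡⟨ cong (λ l → (l ∸ c) / 2) (+-assoc s s c) ⟨
  (s + s + c ∸ c) / 2    ≡⟨ cong (_/ 2) (m+n∸n≡m (s + s) c) ⟩
  (s + s) / 2            ≡⟨ cong (λ l → (s + l) / 2) (+-identityʳ s) ⟨
  (2 * s) / 2            ≡⟨ cong (_/ 2) (*-comm 2 s) ⟩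
  (s * 2) / 2            ≡⟨ m*n/n≡m s 2 ⟩
  s                      ∎)
  where open ≡-Reasoning

odd⇒suc-double : ∀ {n} → 2 ∤ n → ∃[ h ] n ≡ suc (h * 2)
odd⇒suc-double {n} odd with n % 2 | m≡m%n+[m/n]*n n 2 | m%n<n n 2
... | zero        | eq | _                = contradiction (divides (n / 2) eq) odd
... | suc zero    | eq | _                = n / 2 , eq
... | suc (suc _) | _  | s≤s (s≤s ())

theorem5p7 : ∀ (k n : ℕ) → 3 ≤ k → 3 ≤ n → 2 ∤ n → Σ[ S ∈ NAS k n ] IsMaximal S
theorem5p7 k@(suc _) n 3≤k _ n-odd with odd⇒suc-double n-odd | 2 ∣? k
-- For odd `k` only 0 is its own negative, and its contribution `1 ^ n` is rewritten as 1.
... | h , refl | no k-odd =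
  S , (λ _ → halve (trans (cong (λ c → L + (L + c)) (sym (^-zeroˡ n))) counted)) ,
      (λ k-even → contradiction k-even k-odd)
  where
  fixed⁺ : ∀ {x} → neg {k} x ≡ x → x ∈ zero ∷ []
  fixed⁺ {x} eq with neg-fixed⁺ eq
  ... | inj₁ x≡0  = here x≡0
  ... | inj₂ 2x≡k = contradiction (divides (toℕ x) (sym 2x≡k)) k-odd
  construction = negativeAvoiding 3≤k h {zero ∷ []} ([] ∷ []) fixed⁺ λ { (here refl) → neg-zero }
  S       = proj₁ construction
  L       = NAS.period S
  counted = proj₂ construction
-- For even `k` both 0 and `q`, the half of `k`, are their own negatives, which gives the term
-- `2 ^ n`.
... | h , refl | yes k-even@(divides q k≡q*2) =
  proj₁ construction , (λ k-odd → contradiction k-even k-odd) , (λ _ → halve (proj₂ construction))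
  where
  q≢0 : NonZero q
  q≢0 = ≢-nonZero (λ q≡0 → 1+n≢0 (trans k≡q*2 (cong (_* 2) q≡0)))
  q<k : q < k
  q<k = subst (q <_) (sym k≡q*2) (m<m*n q 2 {{q≢0}} (s≤s (s≤s z≤n)))
  half : Fin k
  half = fromℕ< q<k
  half*2 : toℕ half * 2 ≡ k
  half*2 = trans (cong (_* 2) (toℕ-fromℕ< q<k)) (sym k≡q*2)
  0≢half : zero ≢ half
  0≢half eq = 0≢1+n (trans (cong (λ x → toℕ x * 2) eq) half*2)
  fixed⁺ : ∀ {x} → neg {k} x ≡ x → x ∈ zero ∷ half ∷ []
  fixed⁺ {x} eq with neg-fixed⁺ eq
  ... | inj₁ x≡0  = here x≡0
  ... | inj₂ 2x≡k =
    there (here (toℕ-injective (*-cancelʳ-≡ (toℕ x) (toℕ half) 2 (trans 2x≡k (sym half*2)))))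
  fixed⁻ : ∀ {x} → x ∈ zero ∷ half ∷ [] → neg x ≡ x
  fixed⁻ (here refl)         = neg-zero
  fixed⁻ (there (here refl)) = neg-fixed⁻ half*2
  construction =
    negativeAvoiding 3≤k h {zero ∷ half ∷ []} ((0≢half ∷ []) ∷ [] ∷ []) fixed⁺ fixed⁻
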